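{- For all expressions $D$ and $E$ of $\mathrm{DC}\mu\nu$: $D\longrightarrow_{\mathtt{CBV}}E$ if and only if $(D)^\circ\longrightarrow_{\mathtt{CBN}}(E)^\circ$.
   Context: Syntax. Type variables $X,Y,\dots$ (set $\mathrm{TyVars}$), variables $x,y,z,\dots$ and covariables $\alpha,\beta,\gamma,\dots$ are given, with a fixed involution $(-)'$ between variables and covariables ($x''=x$, $\alpha''=\alpha$). Types of $\mathrm{DC}\mu\nu$: $A::=X\mid A\land A\mid A\lor A\mid\neg A\mid\mu X.A\mid\nu X.A$, where $\mu X.A$ and $\nu X.A$ (binding $X$ in $A$) are formed only if $X\in\mathrm{Pos}(A)$; simultaneously, $\mathrm{Pos}(X)=\mathrm{TyVars}$, $\mathrm{Neg}(X)=\mathrm{TyVars}\setminus\{X\}$, $\mathrm{Pos}(A\land B)=\mathrm{Pos}(A\lor B)=\mathrm{Pos}(A)\cap\mathrm{Pos}(B)$, $\mathrm{Neg}(A\land B)=\mathrm{Neg}(A\lor B)=\mathrm{Neg}(A)\cap\mathrm{Neg}(B)$, $\mathrm{Pos}(\neg A)=\mathrm{Neg}(A)$, $\mathrm{Neg}(\neg A)=\mathrm{Pos}(A)$, $\mathrm{Pos}(\mu X.A)=\mathrm{Pos}(\nu X.A)=\mathrm{Pos}(A)\cup\{X\}$, $\mathrm{Neg}(\mu X.A)=\mathrm{Neg}(\nu X.A)=\mathrm{Neg}(A)\cup\{X\}$. Terms: $M::=x\mid\langle M,M\rangle\mid\langle M\rangle\mathsf{inl}\mid\langle M\rangle\mathsf{inr}\mid[K]\mathsf{not}\mid(S).\alpha\mid\mathsf{in}^{\mu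 X.A}\langle M\rangle\mid\mathsf{coitr}^A_x\langle M,M\rangle$. Coterms: $K::=\alpha\mid[K,K]\mid\mathsf{fst}[K]\mid\mathsf{snd}[K]\mid\mathsf{not}\langle M\rangle\mid x.(S)\mid\mathsf{out}^{\nu X.A}[K]\mid\mathsf{itr}^A_\alpha[K,K]$. Statements: $S::=M\bullet K$. An expression ($D,E,\dots$) is a term ($M,N$), a coterm ($K,L$) or a statement ($S,T$). $(S).\alpha$ binds $\alpha$ in $S$, $x.(S)$ binds $x$ in $S$, $\mathsf{itr}^A_\alpha[K,L]$ binds $\alpha$ in $K$ only, $\mathsf{coitr}^A_x\langle M,N\rangle$ binds $x$ in $M$ only. Types and expressions are identified up to renaming of bound names; substitution is capture-avoiding. Duality transformation. Types: $(X)^\circ=X$, $(\neg A)^\circ=\neg(A)^\circ$, $(A\land B)^\circ=(A)^\circ\lor(B)^\circ$, $(A\lor B)^\circ=(A)^\circ\land(B)^\circ$, $(\mu X.A)^\circ=\nu X.(A)^\circ$, $(\nu X.A)^\circ=\mu X.(A)^\circ$. Expressions: $(x)^\circ=x'$, $(\alpha)^\circ=\alpha'$, $(\langle M,N\rangle)^\circ=[(M)^\circ,(N)^\circ]$, $([K,L])^\circ=\langle(K)^\circ,(L)^\circ\rangle$, $(\langle M\rangle\mathsf{inl})^\circ=\mathsf{fst}[(M)^\circ]$, $(\mathsf{fst}[K])^\circ=\langle(K)^\circ\rangle\mathsf{inl}$, $(\langle M\rangle\mathsf{inr})^\circ=\mathsf{snd}[(M)^\circ]$, $(\mathsf{snd}[K])^\circ=\langle(K)^\circ\rangle\mathsf{inr}$,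 $([K]\mathsf{not})^\circ=\mathsf{not}\langle(K)^\circ\rangle$, $(\mathsf{not}\langle M\rangle)^\circ=[(M)^\circ]\mathsf{not}$, $((S).\alpha)^\circ=\alpha'.((S)^\circ)$, $(x.(S))^\circ=((S)^\circ).x'$, $(M\bullet K)^\circ=(K)^\circ\bullet(M)^\circ$, $(\mathsf{in}^{\mu X.A}\langle M\rangle)^\circ=\mathsf{out}^{\nu X.(A)^\circ}[(M)^\circ]$, $(\mathsf{out}^{\nu X.A}[K])^\circ=\mathsf{in}^{\mu X.(A)^\circ}\langle(K)^\circ\rangle$, $(\mathsf{itr}^A_\alpha[K,L])^\circ=\mathsf{coitr}^{(A)^\circ}_{\alpha'}\langle(K)^\circ,(L)^\circ\rangle$, $(\mathsf{coitr}^A_x\langle M,N\rangle)^\circ=\mathsf{itr}^{(A)^\circ}_{x'}[(M)^\circ,(N)^\circ]$. The operator $\mathsf{mono}$. For a type $C$ and type variable $X$ let $\|C\|_X=0$ if $X$ is not free in $C$, and otherwise $\|X\|_X=1$, $\|A\land B\|_X=\|A\lor B\|_X=\|A\|_X+\|B\|_X+1$, $\|\neg A\|_X=\|A\|_X+1$, $\|\mu Y.A\|_X=\|\nu Y.A\|_X=\|A\|_X+\|A\|_Y+1$. For $X$ not free in $A,B$, the term $\mathsf{mono}^{X.C}_{A,B,x.M}\{N\}$ is defined by recursion on $\|C\|_X$ (newly introduced names $y,z,\alpha,\beta,\gamma$ are fresh): $\mathsf{mono}^{X.X}_{A,B,x.M}\{N\}=(N\bullet x.(M\bullet\alpha)).\alpha$;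 $\mathsf{mono}^{X.C}_{A,B,x.M}\{N\}=N$ if $X$ does not occur in $C$; $\mathsf{mono}^{X.C\land D}_{A,B,x.M}\{N\}=\langle\mathsf{mono}^{X.C}_{A,B,x.M}\{(N\bullet\mathsf{fst}[\alpha]).\alpha\},\mathsf{mono}^{X.D}_{A,B,x.M}\{(N\bullet\mathsf{snd}[\beta]).\beta\}\rangle$; $\mathsf{mono}^{X.C\lor D}_{A,B,x.M}\{N\}=(N\bullet[y.(\langle\mathsf{mono}^{X.C}_{A,B,x.M}\{y\}\rangle\mathsf{inl}\bullet\gamma),z.(\langle\mathsf{mono}^{X.D}_{A,B,x.M}\{z\}\rangle\mathsf{inr}\bullet\gamma)]).\gamma$; $\mathsf{mono}^{X.\neg C}_{A,B,x.M}\{N\}=[z.(N\bullet\mathsf{not}\langle\mathsf{mono}^{X.C}_{B,A,x.M}\{z\}\rangle)]\mathsf{not}$; $\mathsf{mono}^{X.\mu Y.C}_{A,B,x.M}\{N\}=(N\bullet\mathsf{itr}^{\mu Y.C[B/X]}_\alpha[z.(\mathsf{in}^{\mu Y.C[B/X]}\langle\mathsf{mono}^{X.C[\mu Y.C[B/X]/Y]}_{A,B,x.M}\{z\}\rangle\bullet\alpha),\beta]).\beta$; $\mathsf{mono}^{X.\nu Y.C}_{A,B,x.M}\{N\}=\mathsf{coitr}^{\nu Y.C[A/X]}_z\langle\mathsf{mono}^{X.C[\nu Y.C[A/X]/Y]}_{A,B,x.M}\{(z\bullet\mathsf{out}^{\nu Y.C[A/X]}[\alpha]).\alpha\},N\rangle$.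 For coterms, $\mathsf{mono}^{X.C}_{A,B,\alpha.K}\{L\}=(\mathsf{mono}^{X.(C)^\circ}_{(B)^\circ,(A)^\circ,\alpha'.(K)^\circ}\{(L)^\circ\})^\circ$. Write $\mathsf{mono}^{X.C}_{A,B,x}\{M,N\}$ for $\mathsf{mono}^{X.C}_{A,B,x.M}\{N\}$ and $\mathsf{mono}^{X.C}_{A,B,\alpha}\{K,L\}$ for $\mathsf{mono}^{X.C}_{A,B,\alpha.K}\{L\}$. Values: $V,W::=x\mid\langle V,V\rangle\mid\langle V\rangle\mathsf{inl}\mid\langle V\rangle\mathsf{inr}\mid[K]\mathsf{not}\mid\mathsf{in}^{\mu X.A}\langle V\rangle\mid\mathsf{coitr}^A_x\langle M,V\rangle$. Covalues: $P,Q::=\alpha\mid[P,P]\mid\mathsf{fst}[P]\mid\mathsf{snd}[P]\mid\mathsf{not}\langle M\rangle\mid\mathsf{out}^{\nu X.A}[P]\mid\mathsf{itr}^A_\alpha[K,P]$ ($M$, $K$ arbitrary). Call-by-value reduction $\longrightarrow_{\mathtt{CBV}}$ is the compatible closure of ($\mathcal M$ ranges over terms that are not values): $\langle V,W\rangle\bullet\mathsf{fst}[K]\to V\bullet K$; $\langle V,W\rangle\bullet\mathsf{snd}[K]\to W\bullet K$; $\langle V\rangle\mathsf{inl}\bullet[K,L]\to V\bullet K$; $\langle W\rangle\mathsf{inr}\bullet[K,L]\to W\bullet L$; $[K]\mathsf{not}\bullet\mathsf{not}\langle M\rangle\to M\bullet K$; $(S).\alpha\bullet K\to S[K/\alpha]$;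 $V\bullet x.(S)\to S[V/x]$; $\mathsf{in}^{\mu X.C}\langle V\rangle\bullet\mathsf{itr}^A_\alpha[K,L]\to(V\bullet\mathsf{mono}^{X.C}_{\mu X.C,A,\beta}\{\mathsf{itr}^A_\alpha[K,\beta],K\}).\alpha\bullet L$; $\mathsf{coitr}^A_x\langle M,V\rangle\bullet\mathsf{out}^{\nu X.C}[K]\to V\bullet x.(\mathsf{mono}^{X.C}_{A,\nu X.C,z}\{\mathsf{coitr}^A_x\langle M,z\rangle,M\}\bullet K)$; $(M\bullet\alpha).\alpha\to M$ and $x.(x\bullet K)\to K$ ($\alpha$ not free in $M$, $x$ not free in $K$); and, with $x,\alpha$ fresh: $\langle\mathcal M,N\rangle\to(\mathcal M\bullet x.(\langle x,N\rangle\bullet\alpha)).\alpha$; $\langle V,\mathcal M\rangle\to(\mathcal M\bullet x.(\langle V,x\rangle\bullet\alpha)).\alpha$; $\langle\mathcal M\rangle\mathsf{inl}\to(\mathcal M\bullet x.(\langle x\rangle\mathsf{inl}\bullet\alpha)).\alpha$; $\langle\mathcal M\rangle\mathsf{inr}\to(\mathcal M\bullet x.(\langle x\rangle\mathsf{inr}\bullet\alpha)).\alpha$; $\mathsf{in}^{\mu X.C}\langle\mathcal M\rangle\to(\mathcal M\bullet x.(\mathsf{in}^{\mu X.C}\langle x\rangle\bullet\alpha)).\alpha$; $\mathsf{coitr}^A_y\langle M,\mathcal M\rangle\to(\mathcal M\bullet x.(\mathsf{coitr}^A_y\langle M,x\rangle\bullet\alpha)).\alpha$. Call-by-name reduction $\longrightarrow_{\mathtt{CBN}}$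 is the compatible closure of ($\mathcal K$ ranges over coterms that are not covalues): $\langle M,N\rangle\bullet\mathsf{fst}[P]\to M\bullet P$; $\langle M,N\rangle\bullet\mathsf{snd}[P]\to N\bullet P$; $\langle M\rangle\mathsf{inl}\bullet[P,Q]\to M\bullet P$; $\langle M\rangle\mathsf{inr}\bullet[P,Q]\to M\bullet Q$; $[K]\mathsf{not}\bullet\mathsf{not}\langle M\rangle\to M\bullet K$; $(S).\alpha\bullet P\to S[P/\alpha]$; $M\bullet x.(S)\to S[M/x]$; $\mathsf{in}^{\mu X.C}\langle M\rangle\bullet\mathsf{itr}^A_\alpha[K,P]\to(M\bullet\mathsf{mono}^{X.C}_{\mu X.C,A,\beta}\{\mathsf{itr}^A_\alpha[K,\beta],K\}).\alpha\bullet P$; $\mathsf{coitr}^A_x\langle M,N\rangle\bullet\mathsf{out}^{\nu X.C}[P]\to N\bullet x.(\mathsf{mono}^{X.C}_{A,\nu X.C,z}\{\mathsf{coitr}^A_x\langle M,z\rangle,M\}\bullet P)$; $(M\bullet\alpha).\alpha\to M$ and $x.(x\bullet K)\to K$ ($\alpha$ not free in $M$, $x$ not free in $K$); and, with $x,\alpha$ fresh: $\mathsf{fst}[\mathcal K]\to x.((x\bullet\mathsf{fst}[\alpha]).\alpha\bullet\mathcal K)$; $\mathsf{snd}[\mathcal K]\to x.((x\bullet\mathsf{snd}[\alpha]).\alpha\bullet\mathcal K)$; $[\mathcal K,L]\to x.((x\bullet[\alpha,L]).\alpha\bullet\mathcal K)$; $[P,\mathcal K]\to x.((x\bullet[P,\alpha]).\alpha\bullet\mathcal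 K)$; $\mathsf{itr}^A_\beta[K,\mathcal K]\to x.((x\bullet\mathsf{itr}^A_\beta[K,\alpha]).\alpha\bullet\mathcal K)$; $\mathsf{out}^{\nu X.C}[\mathcal K]\to x.((x\bullet\mathsf{out}^{\nu X.C}[\alpha]).\alpha\bullet\mathcal K)$. -}

module Defs where

open import Level using (0ℓ)
open import Data.Bool.Base using (if_then_else_)
open import Data.Fin.Base using (Fin; zero; suc; lift)
open import Data.Fin.Properties using (_≟_; suc-injective)
open import Data.Nat.Base using (ℕ; zero; suc; _+_; _<_; s≤s)
open import Data.Nat.Induction using (Acc; acc; <-wellFounded)
open import Data.Nat.Properties using (m≤m+n; m≤n+m; ≤-reflexive; ≤-trans; +-comm)
open import Data.Product.Base using (_×_; _,_)
import Data.Product.Base as Product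
open import Data.Sum.Base using (inj₁; inj₂)
import Data.Sum.Base as Sum
open import Data.Unit.Base using (tt)
open import Data.Vec.Functional using (_∷_)
open import Function.Base using (id; _∘_; _∘′_)
open import Relation.Binary.Core using (Rel)
open import Relation.Binary.PropositionalEquality
  using (_≡_; _≢_; refl; sym; trans; cong; cong₂; subst)
open import Relation.Nullary.Decidable
  using (Dec; yes; no; does; _⊎-dec_; dec-true; dec-false)
open import Relation.Nullary.Negation using (¬_; contradiction)
open import Relation.Unary using (Pred; U; ∁; ｛_｝; _∩_; _∪_; _⊢_; _∈_; _∉_)

-- Syntax is well-scoped de Bruijn, so types and expressions equal up to
-- renaming of bound names are identical.

private variable
  k l m m′ n n′ : ℕ

infixr 7 _∧_
infixr 6 _∨_

-- The scope k lists the type variables.  The positivity proofs are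
-- irrelevant, so they do not affect equality of types.  In Pos and Neg of
-- μX.A the summand {X} disappears: X is not in the scope of μX.A.

data Ty : ℕ → Set
Pos Neg : Ty k → Pred (Fin k) 0ℓ

data Ty where
  var     : Fin k → Ty k
  _∧_ _∨_ : Ty k → Ty k → Ty k
  ¬ᵗ_     : Ty k → Ty k
  μ ν     : (A : Ty (suc k)) → .(zero ∈ Pos A) → Ty k

Pos (var X) = U
Pos (A ∧ B) = Pos A ∩ Pos B
Pos (A ∨ B) = Pos A ∩ Pos B
Pos (¬ᵗ A)  = Neg A
Pos (μ A _) = suc ⊢ Pos A
Pos (ν A _) = suc ⊢ Pos A

Neg (var X) = ∁ ｛ X ｝
Neg (A ∧ B) = Neg A ∩ Neg B
Neg (A ∨ B) = Neg A ∩ Neg B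
Neg (¬ᵗ A)  = Pos A
Neg (μ A _) = suc ⊢ Neg A
Neg (ν A _) = suc ⊢ Neg A

FV : Ty k → Pred (Fin k) 0ℓ
FV (var X) = ｛ X ｝
FV (A ∧ B) = FV A ∪ FV B
FV (A ∨ B) = FV A ∪ FV B
FV (¬ᵗ A)  = FV A
FV (μ A _) = suc ⊢ FV A
FV (ν A _) = suc ⊢ FV A

fv? : (A : Ty k) (X : Fin k) → Dec (X ∈ FV A)
fv? (var Y) X = Y ≟ X
fv? (A ∧ B) X = fv? A X ⊎-dec fv? B X
fv? (A ∨ B) X = fv? A X ⊎-dec fv? B X
fv? (¬ᵗ A)  X = fv? A X
fv? (μ A _) X = fv? A (suc X)
fv? (ν A _) X = fv? A (suc X)

fresh-Pos : (A : Ty k) {X : Fin k} → X ∉ FV A → X ∈ Pos A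
fresh-Neg : (A : Ty k) {X : Fin k} → X ∉ FV A → X ∈ Neg A

fresh-Pos (var Y) _ = tt
fresh-Pos (A ∧ B) f = fresh-Pos A (f ∘ inj₁) , fresh-Pos B (f ∘ inj₂)
fresh-Pos (A ∨ B) f = fresh-Pos A (f ∘ inj₁) , fresh-Pos B (f ∘ inj₂)
fresh-Pos (¬ᵗ A)  f = fresh-Neg A f
fresh-Pos (μ A _) f = fresh-Pos A f
fresh-Pos (ν A _) f = fresh-Pos A f

fresh-Neg (var Y) f = f
fresh-Neg (A ∧ B) f = fresh-Neg A (f ∘ inj₁) , fresh-Neg B (f ∘ inj₂)
fresh-Neg (A ∨ B) f = fresh-Neg A (f ∘ inj₁) , fresh-Neg B (f ∘ inj₂)
fresh-Neg (¬ᵗ A)  f = fresh-Pos A f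
fresh-Neg (μ A _) f = fresh-Neg A f
fresh-Neg (ν A _) f = fresh-Neg A f

-- Traversals of types are defined together with the proof that they preserve
-- the positivity demanded by μ and ν.

OnlyFrom : (Fin k → Fin l) → Fin k → Fin l → Set
OnlyFrom ρ X X′ = ∀ Y → ρ Y ≡ X′ → Y ≡ X

onlyFrom-zero : (ρ : Fin k → Fin l) → OnlyFrom (lift 1 ρ) zero zero
onlyFrom-zero ρ zero _ = refl

onlyFrom-suc : {ρ : Fin k → Fin l} {X : Fin k} {X′ : Fin l} →
               OnlyFrom ρ X X′ → OnlyFrom (lift 1 ρ) (suc X) (suc X′)
onlyFrom-suc o (suc Y) e = cong suc (o Y (suc-injective e))

renTy   : (Fin k → Fin l) → Ty k → Ty l
ren-Pos : (ρ : Fin k → Fin l) (A : Ty k) {X : Fin k} {X′ : Fin l} →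
          OnlyFrom ρ X X′ → X ∈ Pos A → X′ ∈ Pos (renTy ρ A)
ren-Neg : (ρ : Fin k → Fin l) (A : Ty k) {X : Fin k} {X′ : Fin l} →
          OnlyFrom ρ X X′ → X ∈ Neg A → X′ ∈ Neg (renTy ρ A)

renTy ρ (var X) = var (ρ X)
renTy ρ (A ∧ B) = renTy ρ A ∧ renTy ρ B
renTy ρ (A ∨ B) = renTy ρ A ∨ renTy ρ B
renTy ρ (¬ᵗ A)  = ¬ᵗ renTy ρ A
renTy ρ (μ A p) = μ (renTy (lift 1 ρ) A) (ren-Pos (lift 1 ρ) A (onlyFrom-zero ρ) p)
renTy ρ (ν A p) = ν (renTy (lift 1 ρ) A) (ren-Pos (lift 1 ρ) A (onlyFrom-zero ρ) p)

ren-Pos ρ (var Y) o _ = tt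
ren-Pos ρ (A ∧ B) o   = Product.map (ren-Pos ρ A o) (ren-Pos ρ B o)
ren-Pos ρ (A ∨ B) o   = Product.map (ren-Pos ρ A o) (ren-Pos ρ B o)
ren-Pos ρ (¬ᵗ A)  o   = ren-Neg ρ A o
ren-Pos ρ (μ A _) o   = ren-Pos (lift 1 ρ) A (onlyFrom-suc o)
ren-Pos ρ (ν A _) o   = ren-Pos (lift 1 ρ) A (onlyFrom-suc o)

ren-Neg ρ (var Y) o q = q ∘ o Y
ren-Neg ρ (A ∧ B) o   = Product.map (ren-Neg ρ A o) (ren-Neg ρ B o)
ren-Neg ρ (A ∨ B) o   = Product.map (ren-Neg ρ A o) (ren-Neg ρ B o)
ren-Neg ρ (¬ᵗ A)  o   = ren-Pos ρ A o
ren-Neg ρ (μ A _) o   = ren-Neg (lift 1 ρ) A (onlyFrom-suc o)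
ren-Neg ρ (ν A _) o   = ren-Neg (lift 1 ρ) A (onlyFrom-suc o)

ren-FV : (ρ : Fin k → Fin l) (A : Ty k) {X : Fin k} {X′ : Fin l} →
         OnlyFrom ρ X X′ → X ∉ FV A → X′ ∉ FV (renTy ρ A)
ren-FV ρ (var Y) o f e        = f (o Y e)
ren-FV ρ (A ∧ B) o f (inj₁ q) = ren-FV ρ A o (f ∘ inj₁) q
ren-FV ρ (A ∧ B) o f (inj₂ q) = ren-FV ρ B o (f ∘ inj₂) q
ren-FV ρ (A ∨ B) o f (inj₁ q) = ren-FV ρ A o (f ∘ inj₁) q
ren-FV ρ (A ∨ B) o f (inj₂ q) = ren-FV ρ B o (f ∘ inj₂) q
ren-FV ρ (¬ᵗ A)  o f          = ren-FV ρ A o f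
ren-FV ρ (μ A _) o f          = ren-FV (lift 1 ρ) A (onlyFrom-suc o) f
ren-FV ρ (ν A _) o f          = ren-FV (lift 1 ρ) A (onlyFrom-suc o) f

ren-missed : (ρ : Fin k → Fin l) (A : Ty k) {X′ : Fin l} →
             (∀ Y → ρ Y ≢ X′) → X′ ∉ FV (renTy ρ A)
ren-missed ρ (var Y) f e        = f Y e
ren-missed ρ (A ∧ B) f (inj₁ q) = ren-missed ρ A f q
ren-missed ρ (A ∧ B) f (inj₂ q) = ren-missed ρ B f q
ren-missed ρ (A ∨ B) f (inj₁ q) = ren-missed ρ A f q
ren-missed ρ (A ∨ B) f (inj₂ q) = ren-missed ρ B f q
ren-missed ρ (¬ᵗ A)  f          = ren-missed ρ A f
ren-missed ρ (μ A _) f          =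
  ren-missed (lift 1 ρ) A λ { (suc Y) e → f Y (suc-injective e) }
ren-missed ρ (ν A _) f          =
  ren-missed (lift 1 ρ) A λ { (suc Y) e → f Y (suc-injective e) }

wkTy : Ty k → Ty (suc k)
wkTy = renTy suc

liftTy : (Fin k → Ty l) → Fin (suc k) → Ty (suc l)
liftTy σ = var zero ∷ (wkTy ∘ σ)

-- σ sends X to X′, and X′ is fresh for the image of every other variable.
Isolates : (Fin k → Ty l) → Fin k → Fin l → Set
Isolates σ X X′ = σ X ≡ var X′ × (∀ Y → Y ≢ X → X′ ∉ FV (σ Y))

isolates-zero : (σ : Fin k → Ty l) → Isolates (liftTy σ) zero zero
isolates-zero σ = refl , λ where
  zero    Y≢0 → contradiction refl Y≢0
  (suc Y) _   → ren-missed suc (σ Y) λ _ ()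

isolates-suc : {σ : Fin k → Ty l} {X : Fin k} {X′ : Fin l} →
               Isolates σ X X′ → Isolates (liftTy σ) (suc X) (suc X′)
isolates-suc {σ = σ} (e , f) = cong wkTy e , λ where
  zero    _   ()
  (suc Y) Y≢X → ren-FV suc (σ Y) (λ _ → suc-injective) (f Y (Y≢X ∘ cong suc))

subTy   : (Fin k → Ty l) → Ty k → Ty l
sub-Pos : (σ : Fin k → Ty l) (A : Ty k) {X : Fin k} {X′ : Fin l} →
          Isolates σ X X′ → X ∈ Pos A → X′ ∈ Pos (subTy σ A)
sub-Neg : (σ : Fin k → Ty l) (A : Ty k) {X : Fin k} {X′ : Fin l} →
          Isolates σ X X′ → X ∈ Neg A → X′ ∈ Neg (subTy σ A)

subTy σ (var X) = σ X
subTy σ (A ∧ B) = subTy σ A ∧ subTy σ B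
subTy σ (A ∨ B) = subTy σ A ∨ subTy σ B
subTy σ (¬ᵗ A)  = ¬ᵗ subTy σ A
subTy σ (μ A p) = μ (subTy (liftTy σ) A) (sub-Pos (liftTy σ) A (isolates-zero σ) p)
subTy σ (ν A p) = ν (subTy (liftTy σ) A) (sub-Pos (liftTy σ) A (isolates-zero σ) p)

sub-Pos σ (var Y) {X} (e , f) _ with Y ≟ X
... | yes refl = subst (λ A → _ ∈ Pos A) (sym e) tt
... | no  Y≢X  = fresh-Pos (σ Y) (f Y Y≢X)
sub-Pos σ (A ∧ B) i = Product.map (sub-Pos σ A i) (sub-Pos σ B i)
sub-Pos σ (A ∨ B) i = Product.map (sub-Pos σ A i) (sub-Pos σ B i)
sub-Pos σ (¬ᵗ A)  i = sub-Neg σ A i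
sub-Pos σ (μ A _) i = sub-Pos (liftTy σ) A (isolates-suc i)
sub-Pos σ (ν A _) i = sub-Pos (liftTy σ) A (isolates-suc i)

sub-Neg σ (var Y) (_ , f) q = fresh-Neg (σ Y) (f Y q)
sub-Neg σ (A ∧ B) i = Product.map (sub-Neg σ A i) (sub-Neg σ B i)
sub-Neg σ (A ∨ B) i = Product.map (sub-Neg σ A i) (sub-Neg σ B i)
sub-Neg σ (¬ᵗ A)  i = sub-Pos σ A i
sub-Neg σ (μ A _) i = sub-Neg (liftTy σ) A (isolates-suc i)
sub-Neg σ (ν A _) i = sub-Neg (liftTy σ) A (isolates-suc i)

infixl 9 _[_/X]

_[_/X] : Ty (suc k) → Ty k → Ty k
A [ B /X] = subTy (B ∷ var) A

‖_‖_ : Ty k → Fin k → ℕ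
size : Ty k → Fin k → ℕ

‖ C ‖ X = if does (fv? C X) then size C X else 0

size (var _) X = 1
size (A ∧ B) X = ‖ A ‖ X + ‖ B ‖ X + 1
size (A ∨ B) X = ‖ A ‖ X + ‖ B ‖ X + 1
size (¬ᵗ A)  X = ‖ A ‖ X + 1
size (μ A _) X = ‖ A ‖ suc X + ‖ A ‖ zero + 1
size (ν A _) X = ‖ A ‖ suc X + ‖ A ‖ zero + 1

sub-FV⁺ : (σ : Fin k → Ty l) (A : Ty k) {X : Fin k} {X′ : Fin l} →
          Isolates σ X X′ → X ∈ FV A → X′ ∈ FV (subTy σ A)
sub-FV⁺ σ (var Y) (e , _) refl = subst (λ A → _ ∈ FV A) (sym e) refl
sub-FV⁺ σ (A ∧ B) i = Sum.map (sub-FV⁺ σ A i) (sub-FV⁺ σ B i)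
sub-FV⁺ σ (A ∨ B) i = Sum.map (sub-FV⁺ σ A i) (sub-FV⁺ σ B i)
sub-FV⁺ σ (¬ᵗ A)  i = sub-FV⁺ σ A i
sub-FV⁺ σ (μ A _) i = sub-FV⁺ (liftTy σ) A (isolates-suc i)
sub-FV⁺ σ (ν A _) i = sub-FV⁺ (liftTy σ) A (isolates-suc i)

sub-FV⁻ : (σ : Fin k → Ty l) (A : Ty k) {X : Fin k} {X′ : Fin l} →
          Isolates σ X X′ → X′ ∈ FV (subTy σ A) → X ∈ FV A
sub-FV⁻ σ (var Y) {X} (_ , f) q with Y ≟ X
... | yes Y≡X = Y≡X
... | no  Y≢X = contradiction q (f Y Y≢X)
sub-FV⁻ σ (A ∧ B) i = Sum.map (sub-FV⁻ σ A i) (sub-FV⁻ σ B i)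
sub-FV⁻ σ (A ∨ B) i = Sum.map (sub-FV⁻ σ A i) (sub-FV⁻ σ B i)
sub-FV⁻ σ (¬ᵗ A)  i = sub-FV⁻ σ A i
sub-FV⁻ σ (μ A _) i = sub-FV⁻ (liftTy σ) A (isolates-suc i)
sub-FV⁻ σ (ν A _) i = sub-FV⁻ (liftTy σ) A (isolates-suc i)

free-norm : (A : Ty k) {X : Fin k} → X ∈ FV A → ‖ A ‖ X ≡ size A X
free-norm A {X} q = cong (λ b → if b then size A X else 0) (dec-true (fv? A X) q)

fresh-norm : (A : Ty k) {X : Fin k} → X ∉ FV A → ‖ A ‖ X ≡ 0
fresh-norm A {X} f = cong (λ b → if b then size A X else 0) (dec-false (fv? A X) f)

sub-norm : (σ : Fin k → Ty l) (A : Ty k) {X : Fin k} {X′ : Fin l} →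
           Isolates σ X X′ → ‖ subTy σ A ‖ X′ ≡ ‖ A ‖ X
sub-norm σ A {X} {X′} i with fv? A X
... | no  f = fresh-norm (subTy σ A) (f ∘ sub-FV⁻ σ A i)
... | yes q = trans (free-norm (subTy σ A) (sub-FV⁺ σ A i q)) (sub-size σ A i q)
  where
  sub-size : (σ : Fin k → Ty l) (A : Ty k) {X : Fin k} {X′ : Fin l} →
             Isolates σ X X′ → X ∈ FV A → size (subTy σ A) X′ ≡ size A X
  sub-size σ (var Y) (e , _) refl = cong (λ A → size A _) e
  sub-size σ (A ∧ B) i _ = cong₂ (λ a b → a + b + 1) (sub-norm σ A i) (sub-norm σ B i)
  sub-size σ (A ∨ B) i _ = cong₂ (λ a b → a + b + 1) (sub-norm σ A i) (sub-norm σ B i)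
  sub-size σ (¬ᵗ A)  i _ = cong (_+ 1) (sub-norm σ A i)
  sub-size σ (μ A _) i _ = cong₂ (λ a b → a + b + 1)
    (sub-norm (liftTy σ) A (isolates-suc i)) (sub-norm (liftTy σ) A (isolates-zero σ))
  sub-size σ (ν A _) i _ = cong₂ (λ a b → a + b + 1)
    (sub-norm (liftTy σ) A (isolates-suc i)) (sub-norm (liftTy σ) A (isolates-zero σ))

data Sort : Set where
  term coterm stmt : Sort

private variable
  s : Sort

infix 4 _•_

-- Scopes: k type variables, m variables, n covariables.  Index zero is the
-- innermost bound name of its kind.

data Expr (k : ℕ) : Sort → ℕ → ℕ → Set

Term Coterm Stmt : ℕ → ℕ → ℕ → Set
Term   k m n = Expr k term   m n
Coterm k m n = Expr k coterm m n
Stmt   k m n = Expr k stmt   m n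

data Expr k where
  var     : Fin m → Term k m n
  ⟨_,_⟩   : Term k m n → Term k m n → Term k m n
  ⟨_⟩inl  : Term k m n → Term k m n
  ⟨_⟩inr  : Term k m n → Term k m n
  [_]not  : Coterm k m n → Term k m n
  ⦅_⦆α    : Stmt k m (suc n) → Term k m n
  inᵘ     : (A : Ty (suc k)) → .(zero ∈ Pos A) → Term k m n → Term k m n
  coitr   : Ty k → Term k (suc m) n → Term k m n → Term k m n

  covar   : Fin n → Coterm k m n
  [_,_]   : Coterm k m n → Coterm k m n → Coterm k m n
  fst[_]  : Coterm k m n → Coterm k m n
  snd[_]  : Coterm k m n → Coterm k m n
  not⟨_⟩  : Term k m n → Coterm k m n
  x⦅_⦆    : Stmt k (suc m) n → Coterm k m n
  outᵛ    : (A : Ty (suc k)) → .(zero ∈ Pos A) → Coterm k m n → Coterm k m n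
  itr     : Ty k → Coterm k m (suc n) → Coterm k m n → Coterm k m n

  _•_     : Term k m n → Coterm k m n → Stmt k m n

ren : (Fin m → Fin m′) → (Fin n → Fin n′) → Expr k s m n → Expr k s m′ n′
ren ρ τ (var x)       = var (ρ x)
ren ρ τ ⟨ M , N ⟩     = ⟨ ren ρ τ M , ren ρ τ N ⟩
ren ρ τ ⟨ M ⟩inl      = ⟨ ren ρ τ M ⟩inl
ren ρ τ ⟨ M ⟩inr      = ⟨ ren ρ τ M ⟩inr
ren ρ τ [ K ]not      = [ ren ρ τ K ]not
ren ρ τ ⦅ S ⦆α        = ⦅ ren ρ (lift 1 τ) S ⦆α
ren ρ τ (inᵘ A p M)   = inᵘ A p (ren ρ τ M)
ren ρ τ (coitr A M N) = coitr A (ren (lift 1 ρ) τ M) (ren ρ τ N)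
ren ρ τ (covar α)     = covar (τ α)
ren ρ τ [ K , L ]     = [ ren ρ τ K , ren ρ τ L ]
ren ρ τ fst[ K ]      = fst[ ren ρ τ K ]
ren ρ τ snd[ K ]      = snd[ ren ρ τ K ]
ren ρ τ not⟨ M ⟩      = not⟨ ren ρ τ M ⟩
ren ρ τ x⦅ S ⦆        = x⦅ ren (lift 1 ρ) τ S ⦆
ren ρ τ (outᵛ A p K)  = outᵛ A p (ren ρ τ K)
ren ρ τ (itr A K L)   = itr A (ren ρ (lift 1 τ) K) (ren ρ τ L)
ren ρ τ (M • K)       = ren ρ τ M • ren ρ τ K

wkᵛ : Expr k s m n → Expr k s (suc m) n
wkᵛ = ren suc id

wkᶜ : Expr k s m n → Expr k s m (suc n)
wkᶜ = ren id suc

wkᵛᶜ : Expr k s m n → Expr k s (suc m) (suc n)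
wkᵛᶜ = ren suc suc

sub : (Fin m → Term k m′ n′) → (Fin n → Coterm k m′ n′) →
      Expr k s m n → Expr k s m′ n′
sub σ τ (var x)       = σ x
sub σ τ ⟨ M , N ⟩     = ⟨ sub σ τ M , sub σ τ N ⟩
sub σ τ ⟨ M ⟩inl      = ⟨ sub σ τ M ⟩inl
sub σ τ ⟨ M ⟩inr      = ⟨ sub σ τ M ⟩inr
sub σ τ [ K ]not      = [ sub σ τ K ]not
sub σ τ ⦅ S ⦆α        = ⦅ sub (wkᶜ ∘ σ) (covar zero ∷ (wkᶜ ∘ τ)) S ⦆α
sub σ τ (inᵘ A p M)   = inᵘ A p (sub σ τ M)
sub σ τ (coitr A M N) = coitr A (sub (var zero ∷ (wkᵛ ∘ σ)) (wkᵛ ∘ τ) M) (sub σ τ N)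
sub σ τ (covar α)     = τ α
sub σ τ [ K , L ]     = [ sub σ τ K , sub σ τ L ]
sub σ τ fst[ K ]      = fst[ sub σ τ K ]
sub σ τ snd[ K ]      = snd[ sub σ τ K ]
sub σ τ not⟨ M ⟩      = not⟨ sub σ τ M ⟩
sub σ τ x⦅ S ⦆        = x⦅ sub (var zero ∷ (wkᵛ ∘ σ)) (wkᵛ ∘ τ) S ⦆
sub σ τ (outᵛ A p K)  = outᵛ A p (sub σ τ K)
sub σ τ (itr A K L)   = itr A (sub (wkᶜ ∘ σ) (covar zero ∷ (wkᶜ ∘ τ)) K) (sub σ τ L)
sub σ τ (M • K)       = sub σ τ M • sub σ τ K

infixl 9 _[_/x] _[_/α]

_[_/x] : Expr k s (suc m) n → Term k m n → Expr k s m n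
D [ M /x] = sub (M ∷ var) covar D

_[_/α] : Expr k s m (suc n) → Coterm k m n → Expr k s m n
D [ K /α] = sub var (K ∷ covar) D

infix 10 _°ᵗ _°ˢ _°

_°ᵗ  : Ty k → Ty k
Pos° : (A : Ty k) {X : Fin k} → X ∈ Pos A → X ∈ Pos (A °ᵗ)
Neg° : (A : Ty k) {X : Fin k} → X ∈ Neg A → X ∈ Neg (A °ᵗ)

(var X) °ᵗ = var X
(A ∧ B) °ᵗ = A °ᵗ ∨ B °ᵗ
(A ∨ B) °ᵗ = A °ᵗ ∧ B °ᵗ
(¬ᵗ A)  °ᵗ = ¬ᵗ (A °ᵗ)
(μ A p) °ᵗ = ν (A °ᵗ) (Pos° A p)
(ν A p) °ᵗ = μ (A °ᵗ) (Pos° A p)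

Pos° (var X) = id
Pos° (A ∧ B) = Product.map (Pos° A) (Pos° B)
Pos° (A ∨ B) = Product.map (Pos° A) (Pos° B)
Pos° (¬ᵗ A)  = Neg° A
Pos° (μ A _) = Pos° A
Pos° (ν A _) = Pos° A

Neg° (var X) = id
Neg° (A ∧ B) = Product.map (Neg° A) (Neg° B)
Neg° (A ∨ B) = Product.map (Neg° A) (Neg° B)
Neg° (¬ᵗ A)  = Pos° A
Neg° (μ A _) = Neg° A
Neg° (ν A _) = Neg° A

_°ˢ : Sort → Sort
term   °ˢ = coterm
coterm °ˢ = term
stmt   °ˢ = stmt

-- The involution (-)′ pairs the variable and the covariable with the same
-- index, so the two scopes trade places.

_° : Expr k s m n → Expr k (s °ˢ) n m
(var x)       ° = covar x
⟨ M , N ⟩     ° = [ M ° , N ° ]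
⟨ M ⟩inl      ° = fst[ M ° ]
⟨ M ⟩inr      ° = snd[ M ° ]
[ K ]not      ° = not⟨ K ° ⟩
⦅ S ⦆α        ° = x⦅ S ° ⦆
(inᵘ A p M)   ° = outᵛ (A °ᵗ) (Pos° A p) (M °)
(coitr A M N) ° = itr (A °ᵗ) (M °) (N °)
(covar α)     ° = var α
[ K , L ]     ° = ⟨ K ° , L ° ⟩
fst[ K ]      ° = ⟨ K ° ⟩inl
snd[ K ]      ° = ⟨ K ° ⟩inr
not⟨ M ⟩      ° = [ M ° ]not
x⦅ S ⦆        ° = ⦅ S ° ⦆α
(outᵛ A p K)  ° = inᵘ (A °ᵗ) (Pos° A p) (K °)
(itr A K L)   ° = coitr (A °ᵗ) (K °) (L °)
(M • K)       ° = K ° • M °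

left-< : {a b c : ℕ} → c ≡ a + b + 1 → a < c
left-< {a} {b} refl = ≤-trans (s≤s (m≤m+n a b)) (≤-reflexive (+-comm 1 (a + b)))

right-< : {a b c : ℕ} → c ≡ a + b + 1 → b < c
right-< {a} {b} refl = ≤-trans (s≤s (m≤n+m b a)) (≤-reflexive (+-comm 1 (a + b)))

unfold-norm : (C : Ty (suc (suc k))) (T : Ty k) → ‖ C [ wkTy T /X] ‖ zero ≡ ‖ C ‖ suc zero
unfold-norm C T = sub-norm (wkTy T ∷ var) C
  ( refl
  , λ { zero          _ → ren-missed suc T λ _ ()
      ; (suc zero)    f → contradiction refl f
      ; (suc (suc Y)) _ () } )

-- In mono C A B M N for mono^{X.C}_{A,B,x.M}{N}, the type variable X is index
-- zero of C (hence absent from A and B) and x is index zero of M.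
--
-- The decision argument makes the clause for X not free in C take precedence
-- over those for the connectives.

mono-rec : (C : Ty (suc k)) → Acc _<_ (‖ C ‖ zero) → Dec (zero ∈ FV C) →
           (A B : Ty k) → Term k (suc m) n → Term k m n → Term k m n
mono-rec C _ (no _) A B M N = N
mono-rec (var zero) _ (yes _) A B M N =
  ⦅ wkᶜ N • x⦅ wkᶜ M • covar zero ⦆ ⦆α
mono-rec (C ∧ D) (acc r) (yes q) A B M N =
  ⟨ mono-rec C (r (left-<  (free-norm (C ∧ D) q))) (fv? C zero) A B M
      ⦅ wkᶜ N • fst[ covar zero ] ⦆α
  , mono-rec D (r (right-< {‖ C ‖ zero} (free-norm (C ∧ D) q))) (fv? D zero) A B M
      ⦅ wkᶜ N • snd[ covar zero ] ⦆α
  ⟩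
mono-rec (C ∨ D) (acc r) (yes q) A B M N =
  ⦅ wkᶜ N • [ x⦅ ⟨ mono-rec C (r (left-< (free-norm (C ∨ D) q))) (fv? C zero) A B
                     (ren (lift 1 suc) suc M) (var zero) ⟩inl • covar zero ⦆
            , x⦅ ⟨ mono-rec D (r (right-< {‖ C ‖ zero} (free-norm (C ∨ D) q))) (fv? D zero) A B
                     (ren (lift 1 suc) suc M) (var zero) ⟩inr • covar zero ⦆
            ] ⦆α
mono-rec (¬ᵗ C) (acc r) (yes q) A B M N =
  [ x⦅ wkᵛ N • not⟨ mono-rec C (r (≤-reflexive (trans (+-comm 1 _) (sym (free-norm (¬ᵗ C) q)))))
                      (fv? C zero) B A (ren (lift 1 suc) id M) (var zero) ⟩ ⦆ ]not
mono-rec (μ C p) (acc r) (yes q) A B M N =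
  ⦅ wkᶜ N • itr T
      x⦅ inᵘ (subTy σ C) (sub-Pos σ C (isolates-zero (B ∷ var)) p)
           (mono-rec (C [ wkTy T /X]) (r lt) (fv? (C [ wkTy T /X]) zero) A B
             (ren (lift 1 suc) (suc ∘′ suc) M) (var zero))
         • covar zero ⦆
      (covar zero) ⦆α
  where
  σ = liftTy (B ∷ var)
  T = μ C p [ B /X]
  lt : ‖ C [ wkTy T /X] ‖ zero < ‖ μ C p ‖ zero
  lt = subst (_< ‖ μ C p ‖ zero) (sym (unfold-norm C T)) (left-< (free-norm (μ C p) q))
mono-rec (ν C p) (acc r) (yes q) A B M N =
  coitr T
    (mono-rec (C [ wkTy T /X]) (r lt) (fv? (C [ wkTy T /X]) zero) A B
      (ren (lift 1 suc) id M)
      ⦅ var zero • outᵛ (subTy σ C) (sub-Pos σ C (isolates-zero (A ∷ var)) p) (covar zero) ⦆α)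
    N
  where
  σ = liftTy (A ∷ var)
  T = ν C p [ A /X]
  lt : ‖ C [ wkTy T /X] ‖ zero < ‖ ν C p ‖ zero
  lt = subst (_< ‖ ν C p ‖ zero) (sym (unfold-norm C T)) (left-< (free-norm (ν C p) q))

mono : Ty (suc k) → Ty k → Ty k → Term k (suc m) n → Term k m n → Term k m n
mono C = mono-rec C (<-wellFounded _) (fv? C zero)

comono : Ty (suc k) → Ty k → Ty k → Coterm k m (suc n) → Coterm k m n → Coterm k m n
comono C A B K L = mono (C °ᵗ) (B °ᵗ) (A °ᵗ) (K °) (L °) °

data Value {k m n} : Term k m n → Set where
  var    : ∀ {x} → Value (var x)
  ⟨_,_⟩  : ∀ {V W} → Value V → Value W → Value ⟨ V , W ⟩
  ⟨_⟩inl : ∀ {V} → Value V → Value ⟨ V ⟩inl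
  ⟨_⟩inr : ∀ {V} → Value V → Value ⟨ V ⟩inr
  not    : ∀ {K} → Value [ K ]not
  inᵘ    : ∀ {A V} .{p} → Value V → Value (inᵘ A p V)
  coitr  : ∀ {A M V} → Value V → Value (coitr A M V)

data Covalue {k m n} : Coterm k m n → Set where
  covar  : ∀ {α} → Covalue (covar α)
  [_,_]  : ∀ {P Q} → Covalue P → Covalue Q → Covalue [ P , Q ]
  fst[_] : ∀ {P} → Covalue P → Covalue fst[ P ]
  snd[_] : ∀ {P} → Covalue P → Covalue snd[ P ]
  not    : ∀ {M} → Covalue not⟨ M ⟩
  outᵛ   : ∀ {A P} .{p} → Covalue P → Covalue (outᵛ A p P)
  itr    : ∀ {A K P} → Covalue P → Covalue (itr A K P)

ExprRel : ℕ → Set₁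
ExprRel k = ∀ {s m n} → Rel (Expr k s m n) 0ℓ

data Compatible (R : ExprRel k) : ExprRel k where
  base   : {D E : Expr k s m n} → R D E → Compatible R D E

  pair₁  : {M M′ N : Term k m n} → Compatible R M M′ → Compatible R ⟨ M , N ⟩ ⟨ M′ , N ⟩
  pair₂  : {M N N′ : Term k m n} → Compatible R N N′ → Compatible R ⟨ M , N ⟩ ⟨ M , N′ ⟩
  inl    : {M M′ : Term k m n} → Compatible R M M′ → Compatible R ⟨ M ⟩inl ⟨ M′ ⟩inl
  inr    : {M M′ : Term k m n} → Compatible R M M′ → Compatible R ⟨ M ⟩inr ⟨ M′ ⟩inr
  [not]  : {K K′ : Coterm k m n} → Compatible R K K′ → Compatible R [ K ]not [ K′ ]not
  abs    : {S S′ : Stmt k m (suc n)} → Compatible R S S′ → Compatible R ⦅ S ⦆α ⦅ S′ ⦆α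
  inᵘ    : ∀ {A} .{p} {M M′ : Term k m n} → Compatible R M M′ →
           Compatible R (inᵘ A p M) (inᵘ A p M′)
  coitr₁ : ∀ {A} {M M′ : Term k (suc m) n} {N} → Compatible R M M′ →
           Compatible R (coitr A M N) (coitr A M′ N)
  coitr₂ : ∀ {A M} {N N′ : Term k m n} → Compatible R N N′ →
           Compatible R (coitr A M N) (coitr A M N′)

  case₁  : {K K′ L : Coterm k m n} → Compatible R K K′ → Compatible R [ K , L ] [ K′ , L ]
  case₂  : {K L L′ : Coterm k m n} → Compatible R L L′ → Compatible R [ K , L ] [ K , L′ ]
  fst    : {K K′ : Coterm k m n} → Compatible R K K′ → Compatible R fst[ K ] fst[ K′ ]
  snd    : {K K′ : Coterm k m n} → Compatible R K K′ → Compatible R snd[ K ] snd[ K′ ]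
  not⟨⟩  : {M M′ : Term k m n} → Compatible R M M′ → Compatible R not⟨ M ⟩ not⟨ M′ ⟩
  coabs  : {S S′ : Stmt k (suc m) n} → Compatible R S S′ → Compatible R x⦅ S ⦆ x⦅ S′ ⦆
  outᵛ   : ∀ {A} .{p} {K K′ : Coterm k m n} → Compatible R K K′ →
           Compatible R (outᵛ A p K) (outᵛ A p K′)
  itr₁   : ∀ {A} {K K′ : Coterm k m (suc n)} {L} → Compatible R K K′ →
           Compatible R (itr A K L) (itr A K′ L)
  itr₂   : ∀ {A K} {L L′ : Coterm k m n} → Compatible R L L′ →
           Compatible R (itr A K L) (itr A K L′)

  cut₁   : {M M′ : Term k m n} {K : Coterm k m n} → Compatible R M M′ →
           Compatible R (M • K) (M′ • K)
  cut₂   : {M : Term k m n} {K K′ : Coterm k m n} → Compatible R K K′ →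
           Compatible R (M • K) (M • K′)

-- The right-hand sides, apart from the final coterm (resp. initial term) of
-- the cut, of the rules for in • itr and coitr • out; shared by both strategies.
--
--   itr-unfold V   = (V • mono^{X.C}_{μX.C,A,β}{itr_α[K,β],K}).α
--   coitr-unfold L = x.(mono^{X.C}_{A,νX.C,z}{coitr_x⟨M,z⟩,M} • L)
--
-- In itr_α[K,β] the scope is α, β, (outer α), …; the outer α, which is free
-- in the second K, does not occur in the first one.

itr-unfold : (C : Ty (suc k)) → .(zero ∈ Pos C) → (A : Ty k) →
             Coterm k m (suc n) → Term k m n → Term k m n
itr-unfold C p A K V =
  ⦅ wkᶜ V • comono C (μ C p) A (itr A (ren id (lift 1 (suc ∘′ suc)) K) (covar zero)) K ⦆α

coitr-unfold : (C : Ty (suc k)) → .(zero ∈ Pos C) → (A : Ty k) →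
               Term k (suc m) n → Coterm k m n → Coterm k m n
coitr-unfold C p A M L =
  x⦅ mono C A (ν C p) (coitr A (ren (lift 1 (suc ∘′ suc)) id M) (var zero)) M • wkᵛ L ⦆

infix 3 _↦ᵥ_ _↦ₙ_ _⟶CBV_ _⟶CBN_

data _↦ᵥ_ {k} : ExprRel k where
  β-fst : {V W : Term k m n} {K : Coterm k m n} → Value V → Value W →
          ⟨ V , W ⟩ • fst[ K ] ↦ᵥ V • K
  β-snd : {V W : Term k m n} {K : Coterm k m n} → Value V → Value W →
          ⟨ V , W ⟩ • snd[ K ] ↦ᵥ W • K
  β-inl : {V : Term k m n} {K L : Coterm k m n} → Value V →
          ⟨ V ⟩inl • [ K , L ] ↦ᵥ V • K
  β-inr : {W : Term k m n} {K L : Coterm k m n} → Value W →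
          ⟨ W ⟩inr • [ K , L ] ↦ᵥ W • L
  β-not : {M : Term k m n} {K : Coterm k m n} →
          [ K ]not • not⟨ M ⟩ ↦ᵥ M • K
  β-α   : {S : Stmt k m (suc n)} {K : Coterm k m n} →
          ⦅ S ⦆α • K ↦ᵥ S [ K /α]
  β-x   : {V : Term k m n} {S : Stmt k (suc m) n} → Value V →
          V • x⦅ S ⦆ ↦ᵥ S [ V /x]
  β-μ   : ∀ {C A} .{p} {V : Term k m n} {K L} → Value V →
          inᵘ C p V • itr A K L ↦ᵥ itr-unfold C p A K V • L
  β-ν   : ∀ {C A} .{p} {M} {V : Term k m n} {K} → Value V →
          coitr A M V • outᵛ C p K ↦ᵥ V • coitr-unfold C p A M K

  η-α   : {M : Term k m n} → ⦅ wkᶜ M • covar zero ⦆α ↦ᵥ M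
  η-x   : {K : Coterm k m n} → x⦅ var zero • wkᵛ K ⦆ ↦ᵥ K

  ς-pair₁ : {M N : Term k m n} → ¬ Value M →
            ⟨ M , N ⟩ ↦ᵥ ⦅ wkᶜ M • x⦅ ⟨ var zero , wkᵛᶜ N ⟩ • covar zero ⦆ ⦆α
  ς-pair₂ : {V M : Term k m n} → Value V → ¬ Value M →
            ⟨ V , M ⟩ ↦ᵥ ⦅ wkᶜ M • x⦅ ⟨ wkᵛᶜ V , var zero ⟩ • covar zero ⦆ ⦆α
  ς-inl   : {M : Term k m n} → ¬ Value M →
            ⟨ M ⟩inl ↦ᵥ ⦅ wkᶜ M • x⦅ ⟨ var zero ⟩inl • covar zero ⦆ ⦆α
  ς-inr   : {M : Term k m n} → ¬ Value M →
            ⟨ M ⟩inr ↦ᵥ ⦅ wkᶜ M • x⦅ ⟨ var zero ⟩inr • covar zero ⦆ ⦆α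
  ς-in    : ∀ {C} .{p} {M : Term k m n} → ¬ Value M →
            inᵘ C p M ↦ᵥ ⦅ wkᶜ M • x⦅ inᵘ C p (var zero) • covar zero ⦆ ⦆α
  ς-coitr : ∀ {A M} {N : Term k m n} → ¬ Value N →
            coitr A M N ↦ᵥ
            ⦅ wkᶜ N • x⦅ coitr A (ren (lift 1 suc) suc M) (var zero) • covar zero ⦆ ⦆α

data _↦ₙ_ {k} : ExprRel k where
  β-fst : {M N : Term k m n} {P : Coterm k m n} → Covalue P →
          ⟨ M , N ⟩ • fst[ P ] ↦ₙ M • P
  β-snd : {M N : Term k m n} {P : Coterm k m n} → Covalue P →
          ⟨ M , N ⟩ • snd[ P ] ↦ₙ N • P
  β-inl : {M : Term k m n} {P Q : Coterm k m n} → Covalue P → Covalue Q →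
          ⟨ M ⟩inl • [ P , Q ] ↦ₙ M • P
  β-inr : {M : Term k m n} {P Q : Coterm k m n} → Covalue P → Covalue Q →
          ⟨ M ⟩inr • [ P , Q ] ↦ₙ M • Q
  β-not : {M : Term k m n} {K : Coterm k m n} →
          [ K ]not • not⟨ M ⟩ ↦ₙ M • K
  β-α   : {S : Stmt k m (suc n)} {P : Coterm k m n} → Covalue P →
          ⦅ S ⦆α • P ↦ₙ S [ P /α]
  β-x   : {M : Term k m n} {S : Stmt k (suc m) n} →
          M • x⦅ S ⦆ ↦ₙ S [ M /x]
  β-μ   : ∀ {C A} .{p} {M : Term k m n} {K P} → Covalue P →
          inᵘ C p M • itr A K P ↦ₙ itr-unfold C p A K M • P
  β-ν   : ∀ {C A} .{p} {M} {N : Term k m n} {P} → Covalue P →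
          coitr A M N • outᵛ C p P ↦ₙ N • coitr-unfold C p A M P

  η-α   : {M : Term k m n} → ⦅ wkᶜ M • covar zero ⦆α ↦ₙ M
  η-x   : {K : Coterm k m n} → x⦅ var zero • wkᵛ K ⦆ ↦ₙ K

  ς-fst   : {K : Coterm k m n} → ¬ Covalue K →
            fst[ K ] ↦ₙ x⦅ ⦅ var zero • fst[ covar zero ] ⦆α • wkᵛ K ⦆
  ς-snd   : {K : Coterm k m n} → ¬ Covalue K →
            snd[ K ] ↦ₙ x⦅ ⦅ var zero • snd[ covar zero ] ⦆α • wkᵛ K ⦆
  ς-case₁ : {K L : Coterm k m n} → ¬ Covalue K →
            [ K , L ] ↦ₙ x⦅ ⦅ var zero • [ covar zero , wkᵛᶜ L ] ⦆α • wkᵛ K ⦆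
  ς-case₂ : {P K : Coterm k m n} → Covalue P → ¬ Covalue K →
            [ P , K ] ↦ₙ x⦅ ⦅ var zero • [ wkᵛᶜ P , covar zero ] ⦆α • wkᵛ K ⦆
  ς-itr   : ∀ {A K} {L : Coterm k m n} → ¬ Covalue L →
            itr A K L ↦ₙ
            x⦅ ⦅ var zero • itr A (ren suc (lift 1 suc) K) (covar zero) ⦆α • wkᵛ L ⦆
  ς-out   : ∀ {C} .{p} {K : Coterm k m n} → ¬ Covalue K →
            outᵛ C p K ↦ₙ x⦅ ⦅ var zero • outᵛ C p (covar zero) ⦆α • wkᵛ K ⦆

_⟶CBV_ : ExprRel k
_⟶CBV_ = Compatible _↦ᵥ_

_⟶CBN_ : ExprRel k
_⟶CBN_ = Compatible _↦ₙ_

{-# OPTIONS --safe #-}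
-- Duality is an involution that commutes with renaming and substitution, swaps
-- values with covalues and mono with comono, and hence sends every CBV rule to
-- a CBN rule and conversely.  Applied to a CBN step from D° to E° it gives a
-- CBV step from D°° = D to E°° = E.
module Submission where

open import Defs
open import Data.Fin.Base using (Fin; zero; suc; lift)
open import Data.Nat.Base using (ℕ; suc)
open import Data.Vec.Functional using (_∷_)
open import Function.Base using (id; _∘_; _∘′_)
open import Function.Bundles using (_⇔_; mk⇔)
open import Relation.Binary.PropositionalEquality
  using (_≡_; refl; trans; cong; cong₂; subst; subst₂)
open import Relation.Nullary.Negation using (¬_)
open import Relation.Unary using (_∈_)

private variable
  k m m′ n n′ : ℕ
  s : Sort

-- Involutivity of duality.

°ᵗ-involutive : (A : Ty k) → A °ᵗ °ᵗ ≡ A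

-- Plain `cong` does not apply, because the type of the positivity proof depends on the body. Once
-- the bodies are identified, irrelevance makes the two proofs definitionally equal.
μ-cong : {A B : Ty (suc k)} .{p : zero ∈ Pos A} .{q : zero ∈ Pos B} →
         A ≡ B → μ A p ≡ μ B q
μ-cong refl = refl

ν-cong : {A B : Ty (suc k)} .{p : zero ∈ Pos A} .{q : zero ∈ Pos B} →
         A ≡ B → ν A p ≡ ν B q
ν-cong refl = refl

°ᵗ-involutive (var X) = refl
°ᵗ-involutive (A ∧ B) = cong₂ _∧_ (°ᵗ-involutive A) (°ᵗ-involutive B)
°ᵗ-involutive (A ∨ B) = cong₂ _∨_ (°ᵗ-involutive A) (°ᵗ-involutive B)
°ᵗ-involutive (¬ᵗ A)  = cong ¬ᵗ_ (°ᵗ-involutive A)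
°ᵗ-involutive (μ A p) = μ-cong (°ᵗ-involutive A)
°ᵗ-involutive (ν A p) = ν-cong (°ᵗ-involutive A)

inᵘ-cong : {A B : Ty (suc k)} .{p : zero ∈ Pos A} .{q : zero ∈ Pos B}
           {M N : Term k m n} → A ≡ B → M ≡ N → inᵘ A p M ≡ inᵘ B q N
inᵘ-cong refl refl = refl

outᵛ-cong : {A B : Ty (suc k)} .{p : zero ∈ Pos A} .{q : zero ∈ Pos B}
            {K L : Coterm k m n} → A ≡ B → K ≡ L → outᵛ A p K ≡ outᵛ B q L
outᵛ-cong refl refl = refl

coitr-cong : {A B : Ty k} {M M′ : Term k (suc m) n} {N N′ : Term k m n} →
             A ≡ B → M ≡ M′ → N ≡ N′ → coitr A M N ≡ coitr B M′ N′
coitr-cong refl refl refl = refl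

itr-cong : {A B : Ty k} {K K′ : Coterm k m (suc n)} {L L′ : Coterm k m n} →
           A ≡ B → K ≡ K′ → L ≡ L′ → itr A K L ≡ itr B K′ L′
itr-cong refl refl refl = refl

-- The three sorts are separate because s °ˢ °ˢ reduces to s only for concrete s.

°-involutiveᵗ : (M : Term k m n) → M ° ° ≡ M
°-involutiveᶜ : (K : Coterm k m n) → K ° ° ≡ K
°-involutiveˢ : (S : Stmt k m n) → S ° ° ≡ S

°-involutiveᵗ (var x)       = refl
°-involutiveᵗ ⟨ M , N ⟩     = cong₂ ⟨_,_⟩ (°-involutiveᵗ M) (°-involutiveᵗ N)
°-involutiveᵗ ⟨ M ⟩inl      = cong ⟨_⟩inl (°-involutiveᵗ M)
°-involutiveᵗ ⟨ M ⟩inr      = cong ⟨_⟩inr (°-involutiveᵗ M)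
°-involutiveᵗ [ K ]not      = cong [_]not (°-involutiveᶜ K)
°-involutiveᵗ ⦅ S ⦆α        = cong ⦅_⦆α (°-involutiveˢ S)
°-involutiveᵗ (inᵘ A p M)   = inᵘ-cong (°ᵗ-involutive A) (°-involutiveᵗ M)
°-involutiveᵗ (coitr A M N) =
  coitr-cong (°ᵗ-involutive A) (°-involutiveᵗ M) (°-involutiveᵗ N)

°-involutiveᶜ (covar α)     = refl
°-involutiveᶜ [ K , L ]     = cong₂ [_,_] (°-involutiveᶜ K) (°-involutiveᶜ L)
°-involutiveᶜ fst[ K ]      = cong fst[_] (°-involutiveᶜ K)
°-involutiveᶜ snd[ K ]      = cong snd[_] (°-involutiveᶜ K)
°-involutiveᶜ not⟨ M ⟩      = cong not⟨_⟩ (°-involutiveᵗ M)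
°-involutiveᶜ x⦅ S ⦆        = cong x⦅_⦆ (°-involutiveˢ S)
°-involutiveᶜ (outᵛ A p K)  = outᵛ-cong (°ᵗ-involutive A) (°-involutiveᶜ K)
°-involutiveᶜ (itr A K L)   =
  itr-cong (°ᵗ-involutive A) (°-involutiveᶜ K) (°-involutiveᶜ L)

°-involutiveˢ (M • K) = cong₂ _•_ (°-involutiveᵗ M) (°-involutiveᶜ K)

-- Duality against renaming and substitution.

ren-° : (ρ : Fin m → Fin m′) (τ : Fin n → Fin n′) (D : Expr k s m n) →
        (ren ρ τ D) ° ≡ ren τ ρ (D °)
ren-° ρ τ (var x)       = refl
ren-° ρ τ ⟨ M , N ⟩     = cong₂ [_,_] (ren-° ρ τ M) (ren-° ρ τ N)
ren-° ρ τ ⟨ M ⟩inl      = cong fst[_] (ren-° ρ τ M)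
ren-° ρ τ ⟨ M ⟩inr      = cong snd[_] (ren-° ρ τ M)
ren-° ρ τ [ K ]not      = cong not⟨_⟩ (ren-° ρ τ K)
ren-° ρ τ ⦅ S ⦆α        = cong x⦅_⦆ (ren-° ρ (lift 1 τ) S)
ren-° ρ τ (inᵘ A p M)   = outᵛ-cong refl (ren-° ρ τ M)
ren-° ρ τ (coitr A M N) = cong₂ (itr (A °ᵗ)) (ren-° (lift 1 ρ) τ M) (ren-° ρ τ N)
ren-° ρ τ (covar α)     = refl
ren-° ρ τ [ K , L ]     = cong₂ ⟨_,_⟩ (ren-° ρ τ K) (ren-° ρ τ L)
ren-° ρ τ fst[ K ]      = cong ⟨_⟩inl (ren-° ρ τ K)
ren-° ρ τ snd[ K ]      = cong ⟨_⟩inr (ren-° ρ τ K)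
ren-° ρ τ not⟨ M ⟩      = cong [_]not (ren-° ρ τ M)
ren-° ρ τ x⦅ S ⦆        = cong ⦅_⦆α (ren-° (lift 1 ρ) τ S)
ren-° ρ τ (outᵛ A p K)  = inᵘ-cong refl (ren-° ρ τ K)
ren-° ρ τ (itr A K L)   = cong₂ (coitr (A °ᵗ)) (ren-° ρ (lift 1 τ) K) (ren-° ρ τ L)
ren-° ρ τ (M • K)       = cong₂ _•_ (ren-° ρ τ K) (ren-° ρ τ M)

module _ {σ : Fin m → Term k m′ n′} {σ′ : Fin m → Coterm k n′ m′}
         (e : ∀ x → σ x ° ≡ σ′ x) where

  lift-° : ∀ x → (var zero ∷ (wkᵛ ∘ σ)) x ° ≡ (covar zero ∷ (wkᶜ ∘ σ′)) x
  lift-° zero    = refl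
  lift-° (suc x) = trans (ren-° suc id (σ x)) (cong wkᶜ (e x))

  wkᶜ-° : ∀ x → wkᶜ (σ x) ° ≡ wkᵛ (σ′ x)
  wkᶜ-° x = trans (ren-° id suc (σ x)) (cong wkᵛ (e x))

module _ {τ : Fin n → Coterm k m′ n′} {τ′ : Fin n → Term k n′ m′}
         (f : ∀ α → τ α ° ≡ τ′ α) where

  colift-° : ∀ α → (covar zero ∷ (wkᶜ ∘ τ)) α ° ≡ (var zero ∷ (wkᵛ ∘ τ′)) α
  colift-° zero    = refl
  colift-° (suc α) = trans (ren-° id suc (τ α)) (cong wkᵛ (f α))

  wkᵛ-° : ∀ α → wkᵛ (τ α) ° ≡ wkᶜ (τ′ α)
  wkᵛ-° α = trans (ren-° suc id (τ α)) (cong wkᶜ (f α))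

-- The dual substitution is any pair `σ′`, `τ′` agreeing pointwise with the duals of `σ` and `τ`,
-- because under a binder the dual of a lifted substitution is compared with the lift of its dual
-- only pointwise.
sub-° : {σ : Fin m → Term k m′ n′} {σ′ : Fin m → Coterm k n′ m′}
        {τ : Fin n → Coterm k m′ n′} {τ′ : Fin n → Term k n′ m′} →
        (∀ x → σ x ° ≡ σ′ x) → (∀ α → τ α ° ≡ τ′ α) →
        (D : Expr k s m n) → (sub σ τ D) ° ≡ sub τ′ σ′ (D °)
sub-° e f (var x)       = e x
sub-° e f ⟨ M , N ⟩     = cong₂ [_,_] (sub-° e f M) (sub-° e f N)
sub-° e f ⟨ M ⟩inl      = cong fst[_] (sub-° e f M)
sub-° e f ⟨ M ⟩inr      = cong snd[_] (sub-° e f M)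
sub-° e f [ K ]not      = cong not⟨_⟩ (sub-° e f K)
sub-° e f ⦅ S ⦆α        = cong x⦅_⦆ (sub-° (wkᶜ-° e) (colift-° f) S)
sub-° e f (inᵘ A p M)   = outᵛ-cong refl (sub-° e f M)
sub-° e f (coitr A M N) =
  cong₂ (itr (A °ᵗ)) (sub-° (lift-° e) (wkᵛ-° f) M) (sub-° e f N)
sub-° e f (covar α)     = f α
sub-° e f [ K , L ]     = cong₂ ⟨_,_⟩ (sub-° e f K) (sub-° e f L)
sub-° e f fst[ K ]      = cong ⟨_⟩inl (sub-° e f K)
sub-° e f snd[ K ]      = cong ⟨_⟩inr (sub-° e f K)
sub-° e f not⟨ M ⟩      = cong [_]not (sub-° e f M)
sub-° e f x⦅ S ⦆        = cong ⦅_⦆α (sub-° (lift-° e) (wkᵛ-° f) S)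
sub-° e f (outᵛ A p K)  = inᵘ-cong refl (sub-° e f K)
sub-° e f (itr A K L)   =
  cong₂ (coitr (A °ᵗ)) (sub-° (wkᶜ-° e) (colift-° f) K) (sub-° e f L)
sub-° e f (M • K)       = cong₂ _•_ (sub-° e f K) (sub-° e f M)

[/x]-° : (D : Expr k s (suc m) n) (M : Term k m n) → (D [ M /x]) ° ≡ (D °) [ M ° /α]
-- The dual of `M ∷ var` meets `M ° ∷ covar` index by index, since `_∷_` computes only on a
-- constructor; hence the case split.
[/x]-° D M = sub-° (λ { zero → refl ; (suc _) → refl }) (λ _ → refl) D

[/α]-° : (D : Expr k s m (suc n)) (K : Coterm k m n) → (D [ K /α]) ° ≡ (D °) [ K ° /x]
[/α]-° D K = sub-° (λ _ → refl) (λ { zero → refl ; (suc _) → refl }) D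

-- Duality of `mono` and of the (co)iteration unfoldings.

-- `comono` dualises its arguments, applies `mono` and dualises the result, so on arguments that are
-- already duals only double duals remain. Involutivity removes them, with no induction on `C`.
mono-° : (C : Ty (suc k)) (A B : Ty k) (M : Term k (suc m) n) (N : Term k m n) →
         mono C A B M N ° ≡ comono (C °ᵗ) (B °ᵗ) (A °ᵗ) (M °) (N °)
mono-° C A B M N
  rewrite °ᵗ-involutive C | °ᵗ-involutive A | °ᵗ-involutive B
        | °-involutiveᵗ M | °-involutiveᵗ N = refl

-- `comono` is itself a dual, so the outer duality cancels and leaves `mono`, while `(μ C p) °ᵗ`
-- computes to the required ν-type. What remains is to move duality past the weakenings of `K` and
-- `V`.
itr-unfold-° : (C : Ty (suc k)) .(p : zero ∈ Pos C) (A : Ty k)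
               (K : Coterm k m (suc n)) (V : Term k m n) →
               itr-unfold C p A K V ° ≡ coitr-unfold (C °ᵗ) (Pos° C p) (A °ᵗ) (K °) (V °)
itr-unfold-° C p A K V = cong₂ (λ M L → x⦅ M • L ⦆)
  (trans (°-involutiveᵗ _)
         (cong (λ M → mono (C °ᵗ) (A °ᵗ) (ν (C °ᵗ) (Pos° C p)) (coitr (A °ᵗ) M (var zero)) (K °))
               (ren-° id (lift 1 (suc ∘′ suc)) K)))
  (ren-° id suc V)

coitr-unfold-° : (C : Ty (suc k)) .(p : zero ∈ Pos C) (A : Ty k)
                 (M : Term k (suc m) n) (L : Coterm k m n) →
                 coitr-unfold C p A M L ° ≡ itr-unfold (C °ᵗ) (Pos° C p) (A °ᵗ) (M °) (L °)
coitr-unfold-° C p A M L = cong₂ (λ N K → ⦅ N • K ⦆α)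
  (ren-° suc id L)
  -- Here the unfolding contains `mono`, so there is no double dual to cancel; `mono-°` turns its
  -- dual into `comono`.
  (trans (mono-° C A (ν C p) _ M)
         (cong (λ K → comono (C °ᵗ) (μ (C °ᵗ) (Pos° C p)) (A °ᵗ) (itr (A °ᵗ) K (covar zero)) (M °))
               (ren-° (lift 1 (suc ∘′ suc)) id M)))

-- Values and covalues.

Value-° : {V : Term k m n} → Value V → Covalue (V °)
Value-° var       = covar
Value-° ⟨ v , w ⟩ = [ Value-° v , Value-° w ]
Value-° ⟨ v ⟩inl  = fst[ Value-° v ]
Value-° ⟨ v ⟩inr  = snd[ Value-° v ]
Value-° not       = not
Value-° (inᵘ v)   = outᵛ (Value-° v)
Value-° (coitr v) = itr (Value-° v)

Covalue-° : {P : Coterm k m n} → Covalue P → Value (P °)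
Covalue-° covar     = var
Covalue-° [ p , q ] = ⟨ Covalue-° p , Covalue-° q ⟩
Covalue-° fst[ p ]  = ⟨ Covalue-° p ⟩inl
Covalue-° snd[ p ]  = ⟨ Covalue-° p ⟩inr
Covalue-° not       = not
Covalue-° (outᵛ p)  = inᵘ (Covalue-° p)
Covalue-° (itr p)   = coitr (Covalue-° p)

-- The ς rules have negative side conditions, which need the reverse implication: if `M °` were a
-- covalue, its dual would be a value, and that dual is `M`.
¬Value-° : {M : Term k m n} → ¬ Value M → ¬ Covalue (M °)
¬Value-° {M = M} ¬v p = ¬v (subst Value (°-involutiveᵗ M) (Covalue-° p))

¬Covalue-° : {K : Coterm k m n} → ¬ Covalue K → ¬ Value (K °)
¬Covalue-° {K = K} ¬p v = ¬p (subst Covalue (°-involutiveᶜ K) (Value-° v))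

-- Duality of reduction.

-- Arbitrary `R` and `R′` let one induction serve both directions of the equivalence.
Compatible-° : {R R′ : ExprRel k} →
  (∀ {s m n} {D E : Expr k s m n} → R D E → R′ (D °) (E °)) →
  {D E : Expr k s m n} → Compatible R D E → Compatible R′ (D °) (E °)
Compatible-° h (base r)   = base (h r)
Compatible-° h (pair₁ r)  = case₁ (Compatible-° h r)
Compatible-° h (pair₂ r)  = case₂ (Compatible-° h r)
Compatible-° h (inl r)    = fst (Compatible-° h r)
Compatible-° h (inr r)    = snd (Compatible-° h r)
Compatible-° h ([not] r)  = not⟨⟩ (Compatible-° h r)
Compatible-° h (abs r)    = coabs (Compatible-° h r)
Compatible-° h (inᵘ r)    = outᵛ (Compatible-° h r)
Compatible-° h (coitr₁ r) = itr₁ (Compatible-° h r)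
Compatible-° h (coitr₂ r) = itr₂ (Compatible-° h r)
Compatible-° h (case₁ r)  = pair₁ (Compatible-° h r)
Compatible-° h (case₂ r)  = pair₂ (Compatible-° h r)
Compatible-° h (fst r)    = inl (Compatible-° h r)
Compatible-° h (snd r)    = inr (Compatible-° h r)
Compatible-° h (not⟨⟩ r)  = [not] (Compatible-° h r)
Compatible-° h (coabs r)  = abs (Compatible-° h r)
Compatible-° h (outᵛ r)   = inᵘ (Compatible-° h r)
Compatible-° h (itr₁ r)   = coitr₁ (Compatible-° h r)
Compatible-° h (itr₂ r)   = coitr₂ (Compatible-° h r)
Compatible-° h (cut₁ r)   = cut₂ (Compatible-° h r)
Compatible-° h (cut₂ r)   = cut₁ (Compatible-° h r)

-- The rule sets are mirror images, largely by computation. The rewrites supply what does not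
-- compute: duality past a substitution, a weakening or an unfolding.
↦ᵥ⇒↦ₙ : {D E : Expr k s m n} → D ↦ᵥ E → D ° ↦ₙ E °
↦ᵥ⇒↦ₙ (β-fst v w) = β-inl (Value-° v) (Value-° w)
↦ᵥ⇒↦ₙ (β-snd v w) = β-inr (Value-° v) (Value-° w)
↦ᵥ⇒↦ₙ (β-inl v) = β-fst (Value-° v)
↦ᵥ⇒↦ₙ (β-inr w) = β-snd (Value-° w)
↦ᵥ⇒↦ₙ β-not = β-not
↦ᵥ⇒↦ₙ (β-α {S = S} {K}) rewrite [/α]-° S K = β-x
↦ᵥ⇒↦ₙ (β-x {V = V} {S} v) rewrite [/x]-° S V = β-α (Value-° v)
↦ᵥ⇒↦ₙ (β-μ {C = C} {A} {p} {V} {K} v) rewrite itr-unfold-° C p A K V =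
  β-ν (Value-° v)
↦ᵥ⇒↦ₙ (β-ν {C = C} {A} {p} {M} {K = K} v) rewrite coitr-unfold-° C p A M K =
  β-μ (Value-° v)
↦ᵥ⇒↦ₙ (η-α {M = M}) rewrite ren-° id suc M = η-x
↦ᵥ⇒↦ₙ (η-x {K = K}) rewrite ren-° suc id K = η-α
-- The component pulled out is weakened by the new covariable only, the one left behind by both new
-- names.
↦ᵥ⇒↦ₙ (ς-pair₁ {M = M} {N} ¬v) rewrite ren-° id suc M | ren-° suc suc N =
  ς-case₁ (¬Value-° ¬v)
↦ᵥ⇒↦ₙ (ς-pair₂ {V = V} {M} v ¬v) rewrite ren-° id suc M | ren-° suc suc V =
  ς-case₂ (Value-° v) (¬Value-° ¬v)
↦ᵥ⇒↦ₙ (ς-inl {M = M} ¬v) rewrite ren-° id suc M = ς-fst (¬Value-° ¬v)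
↦ᵥ⇒↦ₙ (ς-inr {M = M} ¬v) rewrite ren-° id suc M = ς-snd (¬Value-° ¬v)
↦ᵥ⇒↦ₙ (ς-in {M = M} ¬v) rewrite ren-° id suc M = ς-out (¬Value-° ¬v)
↦ᵥ⇒↦ₙ (ς-coitr {M = M} {N} ¬v) rewrite ren-° id suc N | ren-° (lift 1 suc) suc M =
  ς-itr (¬Value-° ¬v)

-- Matching on a step between `D °` and `E °` would require inverting duality; for a step between
-- arbitrary expressions the rule itself can be matched.
↦ₙ⇒↦ᵥ : {D E : Expr k s m n} → D ↦ₙ E → D ° ↦ᵥ E °
↦ₙ⇒↦ᵥ (β-fst p) = β-inl (Covalue-° p)
↦ₙ⇒↦ᵥ (β-snd p) = β-inr (Covalue-° p)
↦ₙ⇒↦ᵥ (β-inl p q) = β-fst (Covalue-° p) (Covalue-° q)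
↦ₙ⇒↦ᵥ (β-inr p q) = β-snd (Covalue-° p) (Covalue-° q)
↦ₙ⇒↦ᵥ β-not = β-not
↦ₙ⇒↦ᵥ (β-α {S = S} {P} p) rewrite [/α]-° S P = β-x (Covalue-° p)
↦ₙ⇒↦ᵥ (β-x {M = M} {S}) rewrite [/x]-° S M = β-α
↦ₙ⇒↦ᵥ (β-μ {C = C} {A} {p} {M} {K} q) rewrite itr-unfold-° C p A K M =
  β-ν (Covalue-° q)
↦ₙ⇒↦ᵥ (β-ν {C = C} {A} {p} {M} {P = P} q) rewrite coitr-unfold-° C p A M P =
  β-μ (Covalue-° q)
↦ₙ⇒↦ᵥ (η-α {M = M}) rewrite ren-° id suc M = η-x
↦ₙ⇒↦ᵥ (η-x {K = K}) rewrite ren-° suc id K = η-α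
↦ₙ⇒↦ᵥ (ς-fst {K = K} ¬p) rewrite ren-° suc id K = ς-inl (¬Covalue-° ¬p)
↦ₙ⇒↦ᵥ (ς-snd {K = K} ¬p) rewrite ren-° suc id K = ς-inr (¬Covalue-° ¬p)
↦ₙ⇒↦ᵥ (ς-case₁ {K = K} {L} ¬p) rewrite ren-° suc id K | ren-° suc suc L =
  ς-pair₁ (¬Covalue-° ¬p)
↦ₙ⇒↦ᵥ (ς-case₂ {P = P} {K} p ¬p) rewrite ren-° suc id K | ren-° suc suc P =
  ς-pair₂ (Covalue-° p) (¬Covalue-° ¬p)
↦ₙ⇒↦ᵥ (ς-itr {K = K} {L} ¬p) rewrite ren-° suc id L | ren-° suc (lift 1 suc) K =
  ς-coitr (¬Covalue-° ¬p)
↦ₙ⇒↦ᵥ (ς-out {K = K} ¬p) rewrite ren-° suc id K = ς-in (¬Covalue-° ¬p)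

-- The dualised step relates expressions of sort `s °ˢ °ˢ`. The case split on `s` makes this sort
-- compute to `s`, so that the involutivity equations are well-typed.
⟶CBV-°⁻ : (D E : Expr k s m n) → D ° ⟶CBN E ° → D ⟶CBV E
⟶CBV-°⁻ {s = term}   D E r =
  subst₂ _⟶CBV_ (°-involutiveᵗ D) (°-involutiveᵗ E) (Compatible-° ↦ₙ⇒↦ᵥ r)
⟶CBV-°⁻ {s = coterm} D E r =
  subst₂ _⟶CBV_ (°-involutiveᶜ D) (°-involutiveᶜ E) (Compatible-° ↦ₙ⇒↦ᵥ r)
⟶CBV-°⁻ {s = stmt}   D E r =
  subst₂ _⟶CBV_ (°-involutiveˢ D) (°-involutiveˢ E) (Compatible-° ↦ₙ⇒↦ᵥ r)

proposition7p20 : ∀ {k : ℕ} {s : Sort} {m n : ℕ} (D E : Expr k s m n) →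
    (D ⟶CBV E) ⇔ ((D °) ⟶CBN (E °))
proposition7p20 D E = mk⇔ (Compatible-° ↦ᵥ⇒↦ₙ) (⟶CBV-°⁻ D E)
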